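{- For any formula $A$ of the language of $\mathsf{ILL}_\bot$, one obtains the linear Kuroda translation $A^{\rm lKu}$ from the inner Kolmogorov translation $A^{{\rm K}_i}$ by systematically applying the following formula reductions, starting from the atomic formulas and inductively applying them to composite formulas: $$\neg\neg(\neg\neg A\otimes\neg\neg B)\mapsto\neg\neg(A\otimes B),\qquad \neg\neg(\neg\neg A\oplus\neg\neg B)\mapsto\neg\neg(A\oplus B),$$ $$\neg\neg(\neg\neg A\multimap\neg\neg B)\mapsto\neg\neg(A\multimap\neg\neg B),\qquad \neg\neg\exists x\,\neg\neg A\mapsto\neg\neg\exists x\,A.$$ Hence $(\cdot)^{\rm lKu}$ is a simplification from inside of $(\cdot)^{{\rm K}_i}$ (as translations from $\mathsf{CLL}_{\rm b}$ to $\mathsf{ILL}_\bot$). Moreover, the reductions above are reversible in $\mathsf{ILL}_\bot$ (i.e. the two sides of each reduction are provably equivalent in $\mathsf{ILL}_\bot$).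
   Context: Intuitionistic linear logic $\mathsf{ILL}$ (first order). Formulas are built from atomic formulas, including the constants $1,\top,0$, using $\otimes,\&,\oplus,\multimap$, $\forall x,\exists x$ and $!$. Sequents are $\Gamma\vdash A$ with $\Gamma$ a finite multiset of formulas and exactly one formula on the right. Axioms: $A\vdash A$; $\vdash 1$; $\Gamma\vdash\top$; $\Gamma,0\vdash C$. Rules (premises $\Rightarrow$ conclusion): (cut) $\Gamma\vdash A;\ \Delta,A\vdash C\Rightarrow\Gamma,\Delta\vdash C$; $\Gamma\vdash C\Rightarrow\Gamma,1\vdash C$; $\Gamma\vdash A;\ \Delta\vdash B\Rightarrow\Gamma,\Delta\vdash A\otimes B$; $\Gamma,A,B\vdash C\Rightarrow\Gamma,A\otimes B\vdash C$; $\Gamma,A\vdash B\Rightarrow\Gamma\vdash A\multimap B$; $\Gamma\vdash A;\ \Delta,B\vdash C\Rightarrow\Gamma,\Delta,A\multimap B\vdash C$; $\Gamma\vdash A;\ \Gamma\vdash B\Rightarrow\Gamma\vdash A\& B$; $\Gamma,A\vdash C\Rightarrow\Gamma,A\& B\vdash C$; $\Gamma,B\vdash C\Rightarrow\Gamma,A\& B\vdash C$; $\Gamma\vdash A\Rightarrow\Gamma\vdash A\oplus B$; $\Gamma\vdash B\Rightarrow\Gamma\vdash A\oplus B$; $\Gamma,A\vdash C;\ \Gamma,B\vdash C\Rightarrow\Gamma,A\oplus B\vdash C$; $\Gamma\vdash A\Rightarrow\Gamma\vdash\forall xA$; $\Gamma,A[t/x]\vdash C\Rightarrow\Gamma,\forall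 xA\vdash C$; $\Gamma\vdash A[t/x]\Rightarrow\Gamma\vdash\exists xA$; $\Gamma,A\vdash C\Rightarrow\Gamma,\exists xA\vdash C$ (usual eigenvariable conditions); $\Gamma,!A,!A\vdash C\Rightarrow\Gamma,!A\vdash C$; $\Gamma\vdash C\Rightarrow\Gamma,!A\vdash C$; $!\Gamma\vdash A\Rightarrow\,!\Gamma\vdash\,!A$; $\Gamma,A\vdash C\Rightarrow\Gamma,!A\vdash C$. $\mathsf{ILL}_\bot$ extends $\mathsf{ILL}$ by one more constant $\bot$ (also counted as atomic); its sequents have at most one formula on the right (so $C$ in the rules above may be absent), and it has the additional axiom $\bot\vdash$ and rule $\Gamma\vdash\ \Rightarrow\Gamma\vdash\bot$. $\neg A:=A\multimap\bot$. $\mathsf{DNE}$: $\neg\neg A\vdash A$ (axiom schema). $\mathsf{CLL}_{\rm b}:=\mathsf{ILL}_\bot+\mathsf{DNE}$. Formulas $A,B$ are equivalent over $S$ if $S$ proves $(A\multimap B)\&(B\multimap A)$. Translations. Throughout $\square\in\{\otimes,\&,\oplus,\multimap\}$, $Q\in\{\forall x,\exists x,!\}$. Inner Kolmogorov: $A^{{\rm K}_i}:=\neg\neg A_{{\rm K}_i}$ where $P_{{\rm K}_i}:=P$ ($P$ atomic), $(A\,\square\,B)_{{\rm K}_i}:=\neg\neg A_{{\rm K}_i}\,\square\,\neg\neg B_{{\rm K}_i}$, $(QA)_{{\rm K}_i}:=Q\,\neg\neg A_{{\rm K}_i}$. Linear Kuroda: $A^{\rm lKu}:=\neg\neg A_{\rm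 lKu}$ where $P_{\rm lKu}:=P$ ($P$ atomic); $(A\otimes B)_{\rm lKu}:=A_{\rm lKu}\otimes B_{\rm lKu}$; $(A\& B)_{\rm lKu}:=\neg\neg A_{\rm lKu}\&\neg\neg B_{\rm lKu}$; $(A\oplus B)_{\rm lKu}:=A_{\rm lKu}\oplus B_{\rm lKu}$; $(A\multimap B)_{\rm lKu}:=A_{\rm lKu}\multimap\neg\neg B_{\rm lKu}$; $(\forall xA)_{\rm lKu}:=\forall x\,\neg\neg A_{\rm lKu}$; $(\exists xA)_{\rm lKu}:=\exists xA_{\rm lKu}$; $(!A)_{\rm lKu}:=\,!\,\neg\neg A_{\rm lKu}$. General notions, for a formula construct $T$ (here $T(A)=\neg\neg A$). A $T$-based inner-transform is $\mathcal T_\square(A,B)=T'(A)\,\square\,T''(B)$, resp. $\mathcal T_Q(A)=Q(T'(A))$, with $T',T''\in\{T,\mathrm{Id}\}$. A modular inner $T$-translation is one of the form $A^{\rm Tr}:=T(A_{\rm Tr})$ with $P_{\rm Tr}:=P$ ($P$ atomic), $(A\,\square\,B)_{\rm Tr}:=\mathcal T^{\rm Tr}_\square(A_{\rm Tr},B_{\rm Tr})$, $(QA)_{\rm Tr}:=\mathcal T^{\rm Tr}_Q(A_{\rm Tr})$ for inner-transforms $\mathcal T^{\rm Tr}$. A transform is simpler than another one for the same connective, quantifier or modality if the latter uses $T$ in all places where the former does, but not conversely. A translation is sound from $S_1$ to $S_2$ if for all $A$: $\vdash_{S_1}A$ implies $\vdash_{S_2}A^{\rm Tr}$, and $A$, $A^{\rm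 Tr}$ are equivalent over $S_1$. Two sound translations from $S_1$ to $S_2$ are equivalent if $A^{\rm Tr}$ and $A^{{\rm Tr}'}$ are equivalent over $S_2$ for all $A$. For equivalent translations, ${\rm Tr}'$ is a simplification of ${\rm Tr}$ if each transform of ${\rm Tr}'$ is identical to or simpler than the corresponding one of ${\rm Tr}$, and simpler in at least one case. For two equivalent modular inner $T$-translations, ${\rm Tr}'$ is a simplification from inside of ${\rm Tr}$ if it is a simplification of ${\rm Tr}$ and $A^{{\rm Tr}'}$ is obtained from $A^{\rm Tr}$ by applying the reductions $T(\mathcal T^{\rm Tr}_\square(A,B))\mapsto T(\mathcal T^{{\rm Tr}'}_\square(A,B))$ and $T(\mathcal T^{\rm Tr}_Q(A))\mapsto T(\mathcal T^{{\rm Tr}'}_Q(A))$ inductively, starting from the atomic formulas and working towards the whole formula (first reducing the parts that are translations of the immediate subformulas, then applying the reduction matching the resulting whole formula, if there is one). -}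

module Defs where

open import Data.Empty using () renaming (⊥ to Empty)
open import Data.Fin.Base using (Fin)
open import Data.List.Base using (List; []; _∷_; [_]; _++_; map)
open import Data.List.Relation.Binary.Permutation.Propositional using (_↭_)
open import Data.Maybe.Base as Maybe using (Maybe; just; nothing)
open import Data.Nat.Base using (ℕ; zero; suc)
open import Data.Product using (_×_; ∃-syntax)
open import Data.Sum.Base using (_⊎_)
open import Data.Vec.Base as Vec using (Vec)
open import Relation.Binary.PropositionalEquality using (_≡_)
open import Relation.Nullary.Negation using () renaming (¬_ to Not)

record Signature : Set₁ where
  field
    Function  : Set
    arityF    : Function → ℕ
    Predicate : Set
    arityP    : Predicate → ℕ

module LinearLogic (L : Signature) where
  open Signature L

  -- Variables are de Bruijn indices in ℕ, so that, as in the
  -- named syntax, infinitely many free variables are always available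
  -- (and there is always a term to instantiate a quantifier with).

  data Term : Set where
    var : ℕ → Term
    app : (f : Function) → Vec Term (arityF f) → Term

  data Atom : Set where
    pred        : (p : Predicate) → Vec Term (arityP p) → Atom
    one top zer bot : Atom

  data Binary : Set where
    ⟨⊗⟩ ⟨&⟩ ⟨⊕⟩ ⟨⊸⟩ : Binary

  data Unary : Set where
    ⟨∀⟩ ⟨∃⟩ ⟨!⟩ : Unary

  -- un ⟨∀⟩ and un ⟨∃⟩ bind index 0; un ⟨!⟩ binds nothing.
  data Formula : Set where
    atom : Atom → Formula
    bin  : Binary → Formula → Formula → Formula
    un   : Unary → Formula → Formula

  infixr 7 _⊗_ _&_
  infixr 6 _⊕_
  infixr 5 _⊸_
  infix  9 !_ ¬_ ¬¬_

  pattern 𝟏 = atom one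
  pattern ⊤ = atom top
  pattern 𝟎 = atom zer
  pattern ⊥ = atom bot
  pattern _⊗_ A B = bin ⟨⊗⟩ A B
  pattern _&_ A B = bin ⟨&⟩ A B
  pattern _⊕_ A B = bin ⟨⊕⟩ A B
  pattern _⊸_ A B = bin ⟨⊸⟩ A B
  pattern ∀′ A = un ⟨∀⟩ A
  pattern ∃′ A = un ⟨∃⟩ A
  pattern !_ A = un ⟨!⟩ A

  ¬_ ¬¬_ : Formula → Formula
  ¬ A = A ⊸ ⊥
  ¬¬ A = ¬ (¬ A)

  Substitution : Set
  Substitution = ℕ → Term

  mutual
    subTerm : Substitution → Term → Term
    subTerm σ (var x)    = σ x
    subTerm σ (app f ts) = app f (subTerms σ ts)

    subTerms : ∀ {n} → Substitution → Vec Term n → Vec Term n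
    subTerms σ Vec.[]         = Vec.[]
    subTerms σ (t Vec.∷ ts) = subTerm σ t Vec.∷ subTerms σ ts

  shift : Substitution
  shift x = var (suc x)

  lift : Substitution → Substitution
  lift σ zero    = var zero
  lift σ (suc x) = subTerm shift (σ x)

  subAtom : Substitution → Atom → Atom
  subAtom σ (pred p ts) = pred p (subTerms σ ts)
  subAtom σ one = one
  subAtom σ top = top
  subAtom σ zer = zer
  subAtom σ bot = bot

  sub : Substitution → Formula → Formula
  sub σ (atom P)    = atom (subAtom σ P)
  sub σ (bin □ A B) = bin □ (sub σ A) (sub σ B)
  sub σ (∀′ A)      = ∀′ (sub (lift σ) A)
  sub σ (∃′ A)      = ∃′ (sub (lift σ) A)
  sub σ (! A)       = ! (sub σ A)

  ↑_ : Formula → Formula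
  ↑_ = sub shift

  instantiate : Term → Substitution
  instantiate t zero    = t
  instantiate t (suc x) = var x

  infix 10 _[_/0]
  _[_/0] : Formula → Term → Formula
  A [ t /0] = sub (instantiate t) A

  -- Multisets are lists up to the rule `exchange`;
  -- `nothing` is an empty right-hand side.  S A B says that A ⊢ B is an
  -- additional axiom, so S is a system extending intuitionistic linear
  -- logic with ⊥.  Eigenvariable conditions become a shift of the
  -- remaining formulas.

  System : Set₁
  System = Formula → Formula → Set

  infix 3 _∥_⊢_

  data _∥_⊢_ (S : System) : List Formula → Maybe Formula → Set where
    extra : ∀ {A B} → S A B → S ∥ [ A ] ⊢ just B

    exchange : ∀ {Γ Δ C} → Γ ↭ Δ → S ∥ Γ ⊢ C → S ∥ Δ ⊢ C

    ax  : ∀ {A} → S ∥ [ A ] ⊢ just A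
    cut : ∀ {Γ Δ A C} → S ∥ Γ ⊢ just A → S ∥ A ∷ Δ ⊢ C → S ∥ Γ ++ Δ ⊢ C

    𝟏R : S ∥ [] ⊢ just 𝟏
    𝟏L : ∀ {Γ C} → S ∥ Γ ⊢ C → S ∥ 𝟏 ∷ Γ ⊢ C
    ⊤R : ∀ {Γ} → S ∥ Γ ⊢ just ⊤
    𝟎L : ∀ {Γ C} → S ∥ 𝟎 ∷ Γ ⊢ C
    ⊥L : S ∥ [ ⊥ ] ⊢ nothing
    ⊥R : ∀ {Γ} → S ∥ Γ ⊢ nothing → S ∥ Γ ⊢ just ⊥

    ⊗R : ∀ {Γ Δ A B} → S ∥ Γ ⊢ just A → S ∥ Δ ⊢ just B →
         S ∥ Γ ++ Δ ⊢ just (A ⊗ B)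
    ⊗L : ∀ {Γ A B C} → S ∥ A ∷ B ∷ Γ ⊢ C → S ∥ A ⊗ B ∷ Γ ⊢ C

    ⊸R : ∀ {Γ A B} → S ∥ A ∷ Γ ⊢ just B → S ∥ Γ ⊢ just (A ⊸ B)
    ⊸L : ∀ {Γ Δ A B C} → S ∥ Γ ⊢ just A → S ∥ B ∷ Δ ⊢ C →
         S ∥ (A ⊸ B) ∷ Γ ++ Δ ⊢ C

    &R  : ∀ {Γ A B} → S ∥ Γ ⊢ just A → S ∥ Γ ⊢ just B → S ∥ Γ ⊢ just (A & B)
    &L₁ : ∀ {Γ A B C} → S ∥ A ∷ Γ ⊢ C → S ∥ A & B ∷ Γ ⊢ C
    &L₂ : ∀ {Γ A B C} → S ∥ B ∷ Γ ⊢ C → S ∥ A & B ∷ Γ ⊢ C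

    ⊕R₁ : ∀ {Γ A B} → S ∥ Γ ⊢ just A → S ∥ Γ ⊢ just (A ⊕ B)
    ⊕R₂ : ∀ {Γ A B} → S ∥ Γ ⊢ just B → S ∥ Γ ⊢ just (A ⊕ B)
    ⊕L  : ∀ {Γ A B C} → S ∥ A ∷ Γ ⊢ C → S ∥ B ∷ Γ ⊢ C → S ∥ A ⊕ B ∷ Γ ⊢ C

    ∀R : ∀ {Γ A} → S ∥ map ↑_ Γ ⊢ just A → S ∥ Γ ⊢ just (∀′ A)
    ∀L : ∀ {Γ A C} t → S ∥ A [ t /0] ∷ Γ ⊢ C → S ∥ ∀′ A ∷ Γ ⊢ C
    ∃R : ∀ {Γ A} t → S ∥ Γ ⊢ just (A [ t /0]) → S ∥ Γ ⊢ just (∃′ A)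
    ∃L : ∀ {Γ A C} → S ∥ A ∷ map ↑_ Γ ⊢ Maybe.map ↑_ C → S ∥ ∃′ A ∷ Γ ⊢ C

    !contract : ∀ {Γ A C} → S ∥ ! A ∷ ! A ∷ Γ ⊢ C → S ∥ ! A ∷ Γ ⊢ C
    !weaken   : ∀ {Γ A C} → S ∥ Γ ⊢ C → S ∥ ! A ∷ Γ ⊢ C
    !R        : ∀ {Γ A} → S ∥ map !_ Γ ⊢ just A → S ∥ map !_ Γ ⊢ just (! A)
    !L        : ∀ {Γ A C} → S ∥ A ∷ Γ ⊢ C → S ∥ ! A ∷ Γ ⊢ C

  data DNE : System where
    dne : ∀ {A} → DNE (¬¬ A) A

  ILL⊥ CLLb : System
  ILL⊥ _ _ = Empty
  CLLb = DNE

  Provable : System → Formula → Set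
  Provable S A = S ∥ [] ⊢ just A

  Equivalent : System → Formula → Formula → Set
  Equivalent S A B = Provable S ((A ⊸ B) & (B ⊸ A))

  infix 20 _₍Ki₎ _^Ki _₍lKu₎ _^lKu

  _₍Ki₎ : Formula → Formula
  (atom P) ₍Ki₎    = atom P
  (bin □ A B) ₍Ki₎ = bin □ (¬¬ (A ₍Ki₎)) (¬¬ (B ₍Ki₎))
  (un Q A) ₍Ki₎    = un Q (¬¬ (A ₍Ki₎))

  _^Ki : Formula → Formula
  A ^Ki = ¬¬ (A ₍Ki₎)

  _₍lKu₎ : Formula → Formula
  (atom P) ₍lKu₎ = atom P
  (A ⊗ B) ₍lKu₎  = A ₍lKu₎ ⊗ B ₍lKu₎
  (A & B) ₍lKu₎  = ¬¬ (A ₍lKu₎) & ¬¬ (B ₍lKu₎)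
  (A ⊕ B) ₍lKu₎  = A ₍lKu₎ ⊕ B ₍lKu₎
  (A ⊸ B) ₍lKu₎  = A ₍lKu₎ ⊸ ¬¬ (B ₍lKu₎)
  (∀′ A) ₍lKu₎   = ∀′ (¬¬ (A ₍lKu₎))
  (∃′ A) ₍lKu₎   = ∃′ (A ₍lKu₎)
  (! A) ₍lKu₎    = ! ¬¬ (A ₍lKu₎)

  _^lKu : Formula → Formula
  A ^lKu = ¬¬ (A ₍lKu₎)

  data Choice : Set where
    useT useId : Choice

  -- The choices of T or Id at the n argument places of a construct.
  Transform : ℕ → Set
  Transform n = Vec Choice n

  record Transforms : Set where
    field
      transform₂ : Binary → Transform 2
      transform₁ : Unary → Transform 1

  open Transforms

  Translation : Set
  Translation = Formula → Formula

  module _ (T : Formula → Formula) where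

    choose : Choice → Formula → Formula
    choose useT  A = T A
    choose useId A = A

    apply₂ : Transforms → Binary → Formula → Formula → Formula
    apply₂ 𝒯 □ A B =
      bin □ (choose (Vec.lookup (transform₂ 𝒯 □) Fin.zero) A)
            (choose (Vec.lookup (transform₂ 𝒯 □) (Fin.suc Fin.zero)) B)

    apply₁ : Transforms → Unary → Formula → Formula
    apply₁ 𝒯 Q A = un Q (choose (Vec.lookup (transform₁ 𝒯 Q) Fin.zero) A)

    record ModularInner (Tr : Translation) : Set where
      field
        transforms : Transforms
        inner      : Formula → Formula
        outer-eq   : ∀ A → Tr A ≡ T (inner A)
        atom-eq    : ∀ P → inner (atom P) ≡ atom P
        binary-eq  : ∀ □ A B →
                     inner (bin □ A B) ≡ apply₂ transforms □ (inner A) (inner B)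
        unary-eq   : ∀ Q A → inner (un Q A) ≡ apply₁ transforms Q (inner A)

  Sound : System → System → Translation → Set
  Sound S₁ S₂ Tr =
    ∀ A → (Provable S₁ A → Provable S₂ (Tr A)) × Equivalent S₁ A (Tr A)

  record EquivalentTranslations (S₁ S₂ : System) (Tr Tr′ : Translation) : Set where
    field
      sound      : Sound S₁ S₂ Tr
      sound′     : Sound S₁ S₂ Tr′
      equivalent : ∀ A → Equivalent S₂ (Tr A) (Tr′ A)

  _UsesTWherever_ : ∀ {n} → Transform n → Transform n → Set
  t UsesTWherever s =
    ∀ i → Vec.lookup s i ≡ useT → Vec.lookup t i ≡ useT

  _SimplerThan_ : ∀ {n} → Transform n → Transform n → Set
  s SimplerThan t = (t UsesTWherever s) × Not (s UsesTWherever t)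

  record _SimplifiesTransforms_ (𝒯′ 𝒯 : Transforms) : Set where
    field
      binary≤  : ∀ □ → (transform₂ 𝒯′ □ ≡ transform₂ 𝒯 □) ⊎ (transform₂ 𝒯′ □ SimplerThan transform₂ 𝒯 □)
      unary≤   : ∀ Q → (transform₁ 𝒯′ Q ≡ transform₁ 𝒯 Q) ⊎ (transform₁ 𝒯′ Q SimplerThan transform₁ 𝒯 Q)
      somewhere : (∃[ □ ] transform₂ 𝒯′ □ SimplerThan transform₂ 𝒯 □)
                ⊎ (∃[ Q ] transform₁ 𝒯′ Q SimplerThan transform₁ 𝒯 Q)

  Reduction : Set₁
  Reduction = Formula → Formula → Set

  data ApplyIfMatching (_↦_ : Reduction) : Formula → Formula → Set where
    reduce  : ∀ {F G} → F ↦ G → ApplyIfMatching _↦_ F G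
    nomatch : ∀ {F} → (∀ G → Not (F ↦ G)) → ApplyIfMatching _↦_ F F

  -- ReducesInside T 𝒯 _↦_ c F H: F is a translation by the transforms 𝒯
  -- (with its outer T if c is useT, without it if c is useId).  The parts
  -- of F translating the immediate subformulas are reduced first, then the
  -- resulting whole formula is reduced at its root, once, by a matching
  -- instance of _↦_ if there is one; this gives H.
  data ReducesInside (T : Formula → Formula) (𝒯 : Transforms) (_↦_ : Reduction) :
                     Choice → Formula → Formula → Set where
    atomic : ∀ {c P} →
      ReducesInside T 𝒯 _↦_ c (choose T c (atom P)) (choose T c (atom P))
    binary : ∀ {c □ F F′ G G′ H} →
      ReducesInside T 𝒯 _↦_ (Vec.lookup (transform₂ 𝒯 □) Fin.zero) F F′ →
      ReducesInside T 𝒯 _↦_ (Vec.lookup (transform₂ 𝒯 □) (Fin.suc Fin.zero)) G G′ →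
      ApplyIfMatching _↦_ (choose T c (bin □ F′ G′)) H →
      ReducesInside T 𝒯 _↦_ c (choose T c (bin □ F G)) H
    unary : ∀ {c Q F F′ H} →
      ReducesInside T 𝒯 _↦_ (Vec.lookup (transform₁ 𝒯 Q) Fin.zero) F F′ →
      ApplyIfMatching _↦_ (choose T c (un Q F′)) H →
      ReducesInside T 𝒯 _↦_ c (choose T c (un Q F)) H

  data TransformReduction (T : Formula → Formula) (𝒯 𝒯′ : Transforms) : Reduction where
    binary : ∀ □ A B →
      TransformReduction T 𝒯 𝒯′ (T (apply₂ T 𝒯 □ A B)) (T (apply₂ T 𝒯′ □ A B))
    unary : ∀ Q A →
      TransformReduction T 𝒯 𝒯′ (T (apply₁ T 𝒯 Q A)) (T (apply₁ T 𝒯′ Q A))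

  record SimplificationFromInside (T : Formula → Formula) (S₁ S₂ : System)
                                  (Tr′ Tr : Translation) : Set where
    field
      modular    : ModularInner T Tr
      modular′   : ModularInner T Tr′
      equivalent : EquivalentTranslations S₁ S₂ Tr Tr′

    open ModularInner modular using () renaming (transforms to 𝒯)
    open ModularInner modular′ using () renaming (transforms to 𝒯′)

    field
      simplifies : 𝒯′ SimplifiesTransforms 𝒯
      fromInside : ∀ A →
        ReducesInside T 𝒯 (TransformReduction T 𝒯 𝒯′) useT (Tr A) (Tr′ A)

  infix 2 _↦_

  data _↦_ : Reduction where
    red⊗ : ∀ A B → ¬¬ (¬¬ A ⊗ ¬¬ B) ↦ ¬¬ (A ⊗ B)
    red⊕ : ∀ A B → ¬¬ (¬¬ A ⊕ ¬¬ B) ↦ ¬¬ (A ⊕ B)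
    red⊸ : ∀ A B → ¬¬ (¬¬ A ⊸ ¬¬ B) ↦ ¬¬ (A ⊸ ¬¬ B)
    red∃ : ∀ A → ¬¬ (∃′ (¬¬ A)) ↦ ¬¬ (∃′ A)

  kolmogorov : Transforms
  kolmogorov .transform₂ _ = useT Vec.∷ useT Vec.∷ Vec.[]
  kolmogorov .transform₁ _ = useT Vec.∷ Vec.[]

  _⇝_ : Formula → Formula → Set
  F ⇝ H = ReducesInside ¬¬_ kolmogorov _↦_ useT F H

{-# OPTIONS --safe #-}
module Submission where

open import Data.Product using (_×_; _,_; proj₁)
open import Defs

open import Data.Fin.Base using (zero; suc)
open import Data.List.Base using (List; []; _∷_; [_]; _++_; map)
open import Data.List.Properties using (++-identityʳ; map-++; map-∘; map-cong)
open import Data.List.Relation.Binary.Permutation.Propositional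
  using (↭-refl; ↭-sym; swap)
open import Data.List.Relation.Binary.Permutation.Propositional.Properties
  using (map⁺; ++-comm) renaming (shift to ↭-shift)
open import Data.Maybe.Base as Maybe using (Maybe; just; nothing)
open import Data.Nat.Base using (zero; suc)
open import Data.Sum.Base using (inj₁; inj₂)
open import Data.Vec.Base as Vec using (Vec)
open import Function.Base using (_∘_)
open import Relation.Binary.PropositionalEquality
  using (_≡_; refl; sym; trans; cong; cong₂; subst; subst₂)
open import Relation.Nullary.Negation using () renaming (¬_ to Not)

-- Kolmogorov's translation is sound because every ¬¬-formula may be
-- introduced on the right by the rule for its body, and eliminated on the left
-- whenever the right-hand side is empty or negated, which holds throughout a
-- translated derivation.  Kuroda's translation inherits soundness, since the
-- four reductions and the congruence of ⊸-equivalence make it equivalent to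
-- Kolmogorov's.

module _ (L : Signature) where
  open LinearLogic L

  private variable
    S : System
    A B A′ B′ : Formula
    Γ Δ : List Formula
    C : Maybe Formula

  -- Substitutions

  mutual
    subTerm-lift-shift : ∀ σ t →
      subTerm (lift σ) (subTerm shift t) ≡ subTerm shift (subTerm σ t)
    subTerm-lift-shift σ (var x)    = refl
    subTerm-lift-shift σ (app f ts) = cong (app f) (subTerms-lift-shift σ ts)

    subTerms-lift-shift : ∀ σ {n} (ts : Vec Term n) →
      subTerms (lift σ) (subTerms shift ts) ≡ subTerms shift (subTerms σ ts)
    subTerms-lift-shift σ Vec.[]       = refl
    subTerms-lift-shift σ (t Vec.∷ ts) =
      cong₂ Vec._∷_ (subTerm-lift-shift σ t) (subTerms-lift-shift σ ts)

  -- Stated pointwise on variables, this property survives passing under a binder, so cancellation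
  -- on formulas needs no general law for composing substitutions.
  _LeftInverseOf_ : Substitution → Substitution → Set
  σ LeftInverseOf τ = ∀ x → subTerm σ (τ x) ≡ var x

  lift-leftInverse : ∀ {σ τ} → σ LeftInverseOf τ → lift σ LeftInverseOf lift τ
  lift-leftInverse         inv zero    = refl
  lift-leftInverse {σ} {τ} inv (suc x) =
    trans (subTerm-lift-shift σ (τ x)) (cong (subTerm shift) (inv x))

  mutual
    subTerm-leftInverse : ∀ {σ τ} → σ LeftInverseOf τ →
      ∀ t → subTerm σ (subTerm τ t) ≡ t
    subTerm-leftInverse inv (var x)    = inv x
    subTerm-leftInverse inv (app f ts) = cong (app f) (subTerms-leftInverse inv ts)

    subTerms-leftInverse : ∀ {σ τ} → σ LeftInverseOf τ →
      ∀ {n} (ts : Vec Term n) → subTerms σ (subTerms τ ts) ≡ ts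
    subTerms-leftInverse inv Vec.[]       = refl
    subTerms-leftInverse inv (t Vec.∷ ts) =
      cong₂ Vec._∷_ (subTerm-leftInverse inv t) (subTerms-leftInverse inv ts)

  subAtom-leftInverse : ∀ {σ τ} → σ LeftInverseOf τ →
    ∀ P → subAtom σ (subAtom τ P) ≡ P
  subAtom-leftInverse inv (pred p ts) = cong (pred p) (subTerms-leftInverse inv ts)
  subAtom-leftInverse inv one = refl
  subAtom-leftInverse inv top = refl
  subAtom-leftInverse inv zer = refl
  subAtom-leftInverse inv bot = refl

  sub-leftInverse : ∀ {σ τ} → σ LeftInverseOf τ → ∀ A → sub σ (sub τ A) ≡ A
  sub-leftInverse inv (atom P)    = cong atom (subAtom-leftInverse inv P)
  sub-leftInverse inv (bin □ A B) =
    cong₂ (bin □) (sub-leftInverse inv A) (sub-leftInverse inv B)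
  sub-leftInverse inv (∀′ A) = cong ∀′ (sub-leftInverse (lift-leftInverse inv) A)
  sub-leftInverse inv (∃′ A) = cong ∃′ (sub-leftInverse (lift-leftInverse inv) A)
  sub-leftInverse inv (! A)  = cong !_ (sub-leftInverse inv A)

  -- Under an eigenvariable rule the context is shifted, and a quantified formula in it gets the
  -- body `sub (lift shift) A`. Instantiating this body at the eigenvariable `var zero` gives back
  -- the original body.
  instantiate-var0 : ∀ A → (sub (lift shift) A) [ var zero /0] ≡ A
  instantiate-var0 = sub-leftInverse λ where
    zero    → refl
    (suc x) → refl

  -- The translation only inserts `¬¬`, and `⊥` is closed. This lets the quantifier rules be
  -- translated.
  sub-Ki : ∀ σ A → sub σ (A ₍Ki₎) ≡ (sub σ A) ₍Ki₎
  sub-Ki σ (atom P)    = refl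
  sub-Ki σ (bin □ A B) = cong₂ (λ X Y → bin □ (¬¬ X) (¬¬ Y)) (sub-Ki σ A) (sub-Ki σ B)
  sub-Ki σ (∀′ A)      = cong (λ X → ∀′ (¬¬ X)) (sub-Ki (lift σ) A)
  sub-Ki σ (∃′ A)      = cong (λ X → ∃′ (¬¬ X)) (sub-Ki (lift σ) A)
  sub-Ki σ (! A)       = cong (λ X → ! ¬¬ X) (sub-Ki σ A)

  sub-^Ki : ∀ σ A → sub σ (A ^Ki) ≡ (sub σ A) ^Ki
  sub-^Ki σ A = cong ¬¬_ (sub-Ki σ A)

  map-↑-^Ki : ∀ Γ → map _^Ki (map ↑_ Γ) ≡ map ↑_ (map _^Ki Γ)
  map-↑-^Ki Γ = trans (sym (map-∘ Γ))
    (trans (map-cong (λ A → sym (sub-^Ki shift A)) Γ) (map-∘ Γ))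

  Maybe-map-↑-^Ki : ∀ C → Maybe.map _^Ki (Maybe.map ↑_ C) ≡ Maybe.map ↑_ (Maybe.map _^Ki C)
  Maybe-map-↑-^Ki (just A) = cong just (sym (sub-^Ki shift A))
  Maybe-map-↑-^Ki nothing  = refl

  -- Derived rules for negation

  swap₂ : S ∥ A ∷ B ∷ Γ ⊢ C → S ∥ B ∷ A ∷ Γ ⊢ C
  swap₂ = exchange (swap _ _ ↭-refl)

  dropNil : S ∥ Γ ++ [] ⊢ C → S ∥ Γ ⊢ C
  dropNil {S} {Γ} {C} = subst (λ Δ → S ∥ Δ ⊢ C) (++-identityʳ Γ)

  addNil : S ∥ Γ ⊢ C → S ∥ Γ ++ [] ⊢ C
  addNil {S} {Γ} {C} = subst (λ Δ → S ∥ Δ ⊢ C) (sym (++-identityʳ Γ))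

  ¬R : S ∥ A ∷ Γ ⊢ nothing → S ∥ Γ ⊢ just (¬ A)
  ¬R d = ⊸R (⊥R d)

  ¬L : S ∥ Γ ⊢ just A → S ∥ ¬ A ∷ Γ ⊢ nothing
  ¬L d = dropNil (⊸L d ⊥L)

  ¬R⁻¹ : S ∥ Γ ⊢ just (¬ A) → S ∥ A ∷ Γ ⊢ nothing
  ¬R⁻¹ {Γ = Γ} {A = A} d = exchange (++-comm Γ [ A ]) (cut d (¬L ax))

  ¬¬R : S ∥ Γ ⊢ just A → S ∥ Γ ⊢ just (¬¬ A)
  ¬¬R d = ¬R (¬L d)

  -- The right-hand sides that can be emptied: a negation moves to the left as the formula it
  -- negates.
  data Negative : Maybe Formula → Set where
    absent  : Negative nothing
    negated : Negative (just (¬ A))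

  ¬¬L : Negative C → S ∥ A ∷ Γ ⊢ C → S ∥ ¬¬ A ∷ Γ ⊢ C
  ¬¬L absent  d = ¬L (¬R d)
  -- The negated formula waits on the left while `¬¬ A` is opened against an empty right-hand side.
  ¬¬L negated d = ¬R (swap₂ (¬L (¬R (swap₂ (¬R⁻¹ d)))))

  -- `Δ` collects the formulas already rewritten, so that `h` always acts at the head of the
  -- context.
  map-L : ∀ (f g : Formula → Formula) →
    (∀ {A Γ} → S ∥ f A ∷ Γ ⊢ C → S ∥ g A ∷ Γ ⊢ C) →
    ∀ Γ → S ∥ map f Γ ++ Δ ⊢ C → S ∥ map g Γ ++ Δ ⊢ C
  map-L         f g h []      d = d
  map-L {Δ = Δ} f g h (A ∷ Γ) d =
    exchange (↭-shift (g A) (map g Γ) Δ)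
      (map-L f g h Γ (exchange (↭-sym (↭-shift (g A) (map f Γ) Δ)) (h d)))

  -- Congruence

  infix 3 _⊨_⊣⊢_

  _⊨_⊣⊢_ : System → Formula → Formula → Set
  S ⊨ A ⊣⊢ B = S ∥ [ A ] ⊢ just B × S ∥ [ B ] ⊢ just A

  ⊣⊢-refl : S ⊨ A ⊣⊢ A
  ⊣⊢-refl = ax , ax

  ⊣⊢-sym : S ⊨ A ⊣⊢ B → S ⊨ B ⊣⊢ A
  ⊣⊢-sym (d , e) = e , d

  ⊣⊢-trans : ∀ {D} → S ⊨ A ⊣⊢ B → S ⊨ B ⊣⊢ D → S ⊨ A ⊣⊢ D
  ⊣⊢-trans (d , e) (d′ , e′) = cut d d′ , cut e′ e

  ⊣⊢⇒Equivalent : S ⊨ A ⊣⊢ B → Equivalent S A B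
  ⊣⊢⇒Equivalent (d , e) = &R (⊸R d) (⊸R e)

  ⊸-mono : S ∥ [ A′ ] ⊢ just A → S ∥ [ B ] ⊢ just B′ → S ∥ [ A ⊸ B ] ⊢ just (A′ ⊸ B′)
  ⊸-mono d e = ⊸R (swap₂ (⊸L d e))

  -- Both directions are assumed because `⊸` is contravariant in its first argument.
  bin-mono : ∀ □ → S ⊨ A ⊣⊢ A′ → S ⊨ B ⊣⊢ B′ → S ∥ [ bin □ A B ] ⊢ just (bin □ A′ B′)
  bin-mono ⟨⊗⟩ (d , _) (e , _) = ⊗L (⊗R d e)
  bin-mono ⟨&⟩ (d , _) (e , _) = &R (&L₁ d) (&L₂ e)
  bin-mono ⟨⊕⟩ (d , _) (e , _) = ⊕L (⊕R₁ d) (⊕R₂ e)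
  bin-mono ⟨⊸⟩ (_ , d) (e , _) = ⊸-mono d e

  bin-cong : ∀ □ → S ⊨ A ⊣⊢ A′ → S ⊨ B ⊣⊢ B′ → S ⊨ bin □ A B ⊣⊢ bin □ A′ B′
  bin-cong □ p q = bin-mono □ p q , bin-mono □ (⊣⊢-sym p) (⊣⊢-sym q)

  -- ∀L and ∃R at the eigenvariable itself.
  ∀L₀ : S ∥ A ∷ Γ ⊢ C → S ∥ ↑ (∀′ A) ∷ Γ ⊢ C
  ∀L₀ {S} {A} {Γ} {C} d =
    ∀L (var zero) (subst (λ X → S ∥ X ∷ Γ ⊢ C) (sym (instantiate-var0 A)) d)

  ∃R₀ : S ∥ Γ ⊢ just A → S ∥ Γ ⊢ just (↑ (∃′ A))
  ∃R₀ {S} {Γ} {A} d =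
    ∃R (var zero) (subst (λ X → S ∥ Γ ⊢ just X) (sym (instantiate-var0 A)) d)

  un-mono : ∀ Q → S ∥ [ A ] ⊢ just B → S ∥ [ un Q A ] ⊢ just (un Q B)
  un-mono         ⟨∀⟩ d = ∀R (∀L₀ d)
  un-mono         ⟨∃⟩ d = ∃L (∃R₀ d)
  un-mono {A = A} ⟨!⟩ d = !R {Γ = [ A ]} (!L d)

  un-cong : ∀ Q → S ⊨ A ⊣⊢ B → S ⊨ un Q A ⊣⊢ un Q B
  un-cong Q (d , e) = un-mono Q d , un-mono Q e

  ¬¬-cong : S ⊨ A ⊣⊢ B → S ⊨ ¬¬ A ⊣⊢ ¬¬ B
  ¬¬-cong p = bin-cong ⟨⊸⟩ (bin-cong ⟨⊸⟩ p ⊣⊢-refl) ⊣⊢-refl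

  ¬¬-bind : S ∥ [ A ] ⊢ just (¬¬ B) → S ∥ [ ¬¬ A ] ⊢ just (¬¬ B)
  ¬¬-bind = ¬¬L negated

  ¬¬-mono : S ∥ [ A ] ⊢ just B → S ∥ [ ¬¬ A ] ⊢ just (¬¬ B)
  ¬¬-mono d = ¬¬-bind (¬¬R d)

  -- One direction only inserts `¬¬` by `¬¬R`. The other removes `¬¬` from components by `¬¬L`,
  -- which applies because the right-hand side is negated: by the outer `¬¬`, or for `⊸` by the `¬¬`
  -- kept on the consequent. No extra axiom is used, so `S` is arbitrary.
  reduction-⊣⊢ : ∀ {F G} → F ↦ G → S ⊨ F ⊣⊢ G
  reduction-⊣⊢ (red⊗ A B) =
    ¬¬-bind (⊗L (¬¬L negated (swap₂ (¬¬L negated (swap₂ (¬¬R (⊗R ax ax))))))) ,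
    ¬¬-mono (⊗L (⊗R (¬¬R ax) (¬¬R ax)))
  reduction-⊣⊢ (red⊕ A B) =
    ¬¬-bind (⊕L (¬¬-mono (⊕R₁ ax)) (¬¬-mono (⊕R₂ ax))) ,
    ¬¬-mono (⊕L (⊕R₁ (¬¬R ax)) (⊕R₂ (¬¬R ax)))
  reduction-⊣⊢ (red⊸ A B) =
    ¬¬-mono (⊸-mono (¬¬R ax) ax) ,
    ¬¬-mono (⊸R (¬¬L negated (swap₂ (⊸L ax ax))))
  reduction-⊣⊢ (red∃ A) =
    ¬¬-bind (∃L (¬¬-mono (∃R₀ ax))) ,
    ¬¬-mono (un-mono ⟨∃⟩ (¬¬R ax))

  -- Comparison of the translations

  -- By congruence the induction hypotheses replace the translated subformulas; at most one
  -- reduction at the root then remains, and none for `&`, `∀′` and `!`.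
  Ki⊣⊢lKu : ∀ A → S ⊨ A ^Ki ⊣⊢ A ^lKu
  Ki⊣⊢lKu (atom P) = ⊣⊢-refl
  Ki⊣⊢lKu (bin □ A B) =
    ⊣⊢-trans (¬¬-cong (bin-cong □ (Ki⊣⊢lKu A) (Ki⊣⊢lKu B))) (last □)
    where
    last : ∀ □ → _ ⊨ ¬¬ (bin □ (A ^lKu) (B ^lKu)) ⊣⊢ (bin □ A B) ^lKu
    last ⟨⊗⟩ = reduction-⊣⊢ (red⊗ _ _)
    last ⟨&⟩ = ⊣⊢-refl
    last ⟨⊕⟩ = reduction-⊣⊢ (red⊕ _ _)
    last ⟨⊸⟩ = reduction-⊣⊢ (red⊸ _ _)
  Ki⊣⊢lKu (un Q A) = ⊣⊢-trans (¬¬-cong (un-cong Q (Ki⊣⊢lKu A))) (last Q)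
    where
    last : ∀ Q → _ ⊨ ¬¬ (un Q (A ^lKu)) ⊣⊢ (un Q A) ^lKu
    last ⟨∀⟩ = ⊣⊢-refl
    last ⟨∃⟩ = reduction-⊣⊢ (red∃ _)
    last ⟨!⟩ = ⊣⊢-refl

  ¬¬-stable : CLLb ⊨ A ⊣⊢ ¬¬ A
  ¬¬-stable = ¬¬R ax , extra dne

  mutual
    ⊣⊢Ki : ∀ A → CLLb ⊨ A ⊣⊢ A ^Ki
    ⊣⊢Ki A = ⊣⊢-trans (⊣⊢-inner-Ki A) ¬¬-stable

    ⊣⊢-inner-Ki : ∀ A → CLLb ⊨ A ⊣⊢ A ₍Ki₎
    ⊣⊢-inner-Ki (atom P)    = ⊣⊢-refl
    ⊣⊢-inner-Ki (bin □ A B) = bin-cong □ (⊣⊢Ki A) (⊣⊢Ki B)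
    ⊣⊢-inner-Ki (un Q A)    = un-cong Q (⊣⊢Ki A)

  -- Soundness

  negative-Ki : ∀ C → Negative (Maybe.map _^Ki C)
  negative-Ki (just _) = negated
  negative-Ki nothing  = absent

  unmap-++ : ∀ Γ {Δ} → S ∥ map _^Ki Γ ++ map _^Ki Δ ⊢ C → S ∥ map _^Ki (Γ ++ Δ) ⊢ C
  unmap-++ {S} {C} Γ {Δ} = subst (λ Θ → S ∥ Θ ⊢ C) (sym (map-++ _^Ki Γ Δ))

  -- Since `⊥` is itself translated to `¬¬ ⊥`, the left formula is `¬¬ (¬¬ (A ^Ki ⊸ ¬¬ ⊥) ⊸ ¬¬ ⊥)`.
  -- As `¬¬ ⊥` is contradictory, it suffices that `¬ (A ₍Ki₎)` yields `A ^Ki ⊸ ¬¬ ⊥`.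
  Ki-dne : ∀ A → S ∥ [ (¬¬ A) ^Ki ] ⊢ just (A ^Ki)
  Ki-dne A = ¬¬-bind (¬R (swap₂
    (⊸L (¬¬R (⊸R (¬¬R (⊥R (¬L ax))))) (¬¬L absent ⊥L))))

  -- The translated context consists of formulas `¬¬ ! (B ^Ki)`, to which promotion does not apply.
  -- The outer `¬¬` are cut away, promotion is performed, and `¬¬L` restores them below the negated
  -- conclusion.
  Ki-!R : ∀ Γ → S ∥ map _^Ki (map !_ Γ) ⊢ just (A ^Ki) →
    S ∥ map _^Ki (map !_ Γ) ⊢ just ((! A) ^Ki)
  Ki-!R {S} {A} Γ d = subst (λ Δ → S ∥ Δ ⊢ _) (map-∘ Γ) (¬¬L-Γ (¬¬R promoted))
    where
    !Ki : Formula → Formula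
    !Ki B = ! (B ^Ki)

    ¬¬L-Γ : S ∥ map !Ki Γ ⊢ just (¬¬ B) → S ∥ map (¬¬_ ∘ !Ki) Γ ⊢ just (¬¬ B)
    ¬¬L-Γ e = dropNil (map-L !Ki (¬¬_ ∘ !Ki) (¬¬L negated) Γ (addNil e))

    unnegated : S ∥ map !Ki Γ ⊢ just (A ^Ki)
    unnegated = dropNil (map-L (¬¬_ ∘ !Ki) !Ki (cut (¬¬R ax)) Γ
      (addNil (subst (λ Δ → S ∥ Δ ⊢ _) (sym (map-∘ Γ)) d)))

    promoted : S ∥ map !Ki Γ ⊢ just (! (A ^Ki))
    -- The context is regrouped as `map !_` of `map _^Ki Γ`, the form that `!R` demands.
    promoted = subst (λ Δ → S ∥ Δ ⊢ _) (sym (map-∘ Γ))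
      (!R (subst (λ Δ → S ∥ Δ ⊢ _) (map-∘ Γ) unnegated))

  Ki-derivation : CLLb ∥ Γ ⊢ C → ILL⊥ ∥ map _^Ki Γ ⊢ Maybe.map _^Ki C
  Ki-derivation (extra dne) = Ki-dne _
  Ki-derivation (exchange p d) = exchange (map⁺ _^Ki p) (Ki-derivation d)
  Ki-derivation ax = ax
  Ki-derivation (cut {Γ} d e) = unmap-++ Γ (cut (Ki-derivation d) (Ki-derivation e))
  Ki-derivation 𝟏R = ¬¬R 𝟏R
  Ki-derivation (𝟏L {C = C} d) = ¬¬L (negative-Ki C) (𝟏L (Ki-derivation d))
  Ki-derivation ⊤R = ¬¬R ⊤R
  Ki-derivation (𝟎L {C = C}) = ¬¬L (negative-Ki C) 𝟎L
  Ki-derivation ⊥L = ¬¬L absent ⊥L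
  Ki-derivation (⊥R d) = ¬¬R (⊥R (Ki-derivation d))
  Ki-derivation (⊗R {Γ} d e) = unmap-++ Γ (¬¬R (⊗R (Ki-derivation d) (Ki-derivation e)))
  Ki-derivation (⊗L {C = C} d) = ¬¬L (negative-Ki C) (⊗L (Ki-derivation d))
  Ki-derivation (⊸R d) = ¬¬R (⊸R (Ki-derivation d))
  Ki-derivation (⊸L {Γ} {A = A} {B} {C} d e) =
    unmap-++ ((A ⊸ B) ∷ Γ) (¬¬L (negative-Ki C) (⊸L (Ki-derivation d) (Ki-derivation e)))
  Ki-derivation (&R d e) = ¬¬R (&R (Ki-derivation d) (Ki-derivation e))
  Ki-derivation (&L₁ {C = C} d) = ¬¬L (negative-Ki C) (&L₁ (Ki-derivation d))
  Ki-derivation (&L₂ {C = C} d) = ¬¬L (negative-Ki C) (&L₂ (Ki-derivation d))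
  Ki-derivation (⊕R₁ d) = ¬¬R (⊕R₁ (Ki-derivation d))
  Ki-derivation (⊕R₂ d) = ¬¬R (⊕R₂ (Ki-derivation d))
  Ki-derivation (⊕L {C = C} d e) = ¬¬L (negative-Ki C) (⊕L (Ki-derivation d) (Ki-derivation e))
  Ki-derivation (∀R {Γ} d) =
    ¬¬R (∀R (subst (λ Δ → ILL⊥ ∥ Δ ⊢ _) (map-↑-^Ki Γ) (Ki-derivation d)))
  Ki-derivation (∀L {Γ} {A} {C} t d) = ¬¬L (negative-Ki C) (∀L t
    (subst (λ X → ILL⊥ ∥ X ∷ map _^Ki Γ ⊢ Maybe.map _^Ki C)
      (sym (sub-^Ki (instantiate t) A)) (Ki-derivation d)))
  Ki-derivation (∃R {Γ} {A} t d) = ¬¬R (∃R t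
    (subst (λ X → ILL⊥ ∥ map _^Ki Γ ⊢ just X)
      (sym (sub-^Ki (instantiate t) A)) (Ki-derivation d)))
  Ki-derivation (∃L {Γ} {A} {C} d) = ¬¬L (negative-Ki C) (∃L
    (subst₂ (λ Δ D → ILL⊥ ∥ A ^Ki ∷ Δ ⊢ D)
      (map-↑-^Ki Γ) (Maybe-map-↑-^Ki C) (Ki-derivation d)))
  Ki-derivation (!contract {C = C} d) = ¬¬L (negative-Ki C) (!contract
    -- Contraction acts on the bare `!` formula; each copy then regains its `¬¬` by a cut to match
    -- the translated premise.
    (cut (¬¬R ax) (swap₂ (cut (¬¬R ax) (Ki-derivation d)))))
  Ki-derivation (!weaken {C = C} d) = ¬¬L (negative-Ki C) (!weaken (Ki-derivation d))
  Ki-derivation (!R {Γ} d) = Ki-!R Γ (Ki-derivation d)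
  Ki-derivation (!L {C = C} d) = ¬¬L (negative-Ki C) (!L (Ki-derivation d))

  Ki-sound : Sound CLLb ILL⊥ _^Ki
  Ki-sound A = Ki-derivation , ⊣⊢⇒Equivalent (⊣⊢Ki A)

  lKu-sound : Sound CLLb ILL⊥ _^lKu
  lKu-sound A =
    (λ d → cut (Ki-derivation d) (proj₁ (Ki⊣⊢lKu A))) ,
    ⊣⊢⇒Equivalent (⊣⊢-trans (⊣⊢Ki A) (Ki⊣⊢lKu A))

  -- Simplification

  open Transforms

  kuroda : Transforms
  kuroda .transform₂ ⟨⊗⟩ = useId Vec.∷ useId Vec.∷ Vec.[]
  kuroda .transform₂ ⟨&⟩ = useT  Vec.∷ useT  Vec.∷ Vec.[]
  kuroda .transform₂ ⟨⊕⟩ = useId Vec.∷ useId Vec.∷ Vec.[]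
  kuroda .transform₂ ⟨⊸⟩ = useId Vec.∷ useT  Vec.∷ Vec.[]
  kuroda .transform₁ ⟨∀⟩ = useT  Vec.∷ Vec.[]
  kuroda .transform₁ ⟨∃⟩ = useId Vec.∷ Vec.[]
  kuroda .transform₁ ⟨!⟩ = useT  Vec.∷ Vec.[]

  Ki-modular : ModularInner ¬¬_ _^Ki
  Ki-modular = record
    { transforms = kolmogorov
    ; inner      = _₍Ki₎
    ; outer-eq   = λ _ → refl
    ; atom-eq    = λ _ → refl
    ; binary-eq  = λ _ _ _ → refl
    ; unary-eq   = λ _ _ → refl
    }

  lKu-modular : ModularInner ¬¬_ _^lKu
  lKu-modular = record
    { transforms = kuroda
    ; inner      = _₍lKu₎
    ; outer-eq   = λ _ → refl
    ; atom-eq    = λ _ → refl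
    ; binary-eq  = λ { ⟨⊗⟩ _ _ → refl ; ⟨&⟩ _ _ → refl ; ⟨⊕⟩ _ _ → refl ; ⟨⊸⟩ _ _ → refl }
    ; unary-eq   = λ { ⟨∀⟩ _ → refl ; ⟨∃⟩ _ → refl ; ⟨!⟩ _ → refl }
    }

  -- A place with `useId` refutes the converse comparison, which makes the simplification strict.
  useT-maximal : ∀ {n} (t s : Transform n) → (∀ i → Vec.lookup t i ≡ useT) →
    ∀ i → Vec.lookup s i ≡ useId → s SimplerThan t
  useT-maximal t s all i eq =
    (λ j _ → all j) , λ le → useId≢useT (trans (sym eq) (le i (all i)))
    where
    useId≢useT : Not (useId ≡ useT)
    useId≢useT ()

  kuroda-simplifies : kuroda SimplifiesTransforms kolmogorov
  kuroda-simplifies = record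
    { binary≤ = λ
      { ⟨⊗⟩ → inj₂ (simpler₂ ⟨⊗⟩ refl)
      ; ⟨&⟩ → inj₁ refl
      ; ⟨⊕⟩ → inj₂ (simpler₂ ⟨⊕⟩ refl)
      ; ⟨⊸⟩ → inj₂ (simpler₂ ⟨⊸⟩ refl)
      }
    ; unary≤ = λ
      { ⟨∀⟩ → inj₁ refl
      ; ⟨∃⟩ → inj₂ (useT-maximal (transform₁ kolmogorov ⟨∃⟩) (transform₁ kuroda ⟨∃⟩)
               (λ { zero → refl }) zero refl)
      ; ⟨!⟩ → inj₁ refl
      }
    ; somewhere = inj₁ (⟨⊗⟩ , simpler₂ ⟨⊗⟩ refl)
    }
    where
    -- The first argument is a place where `⊗`, `⊕` and `⊸` all lose their `¬¬`.
    simpler₂ : ∀ □ → Vec.lookup (transform₂ kuroda □) zero ≡ useId →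
      transform₂ kuroda □ SimplerThan transform₂ kolmogorov □
    simpler₂ □ = useT-maximal (transform₂ kolmogorov □) (transform₂ kuroda □)
      (λ { zero → refl ; (suc zero) → refl }) zero

  -- One induction serves both the four listed reductions and those induced by the transforms. They
  -- differ at `&`, `∀′` and `!`, where the former have no match and the latter reduce a formula to
  -- itself.
  module _ (_↦′_ : Reduction)
    (apply₂↦ : ∀ □ A B → ApplyIfMatching _↦′_ (¬¬ (bin □ (A ^lKu) (B ^lKu))) ((bin □ A B) ^lKu))
    (apply₁↦ : ∀ Q A → ApplyIfMatching _↦′_ (¬¬ (un Q (A ^lKu))) ((un Q A) ^lKu))
    where

    reducesInside : ∀ A → ReducesInside ¬¬_ kolmogorov _↦′_ useT (A ^Ki) (A ^lKu)
    reducesInside (atom P)    = atomic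
    reducesInside (bin □ A B) = binary (reducesInside A) (reducesInside B) (apply₂↦ □ A B)
    reducesInside (un Q A)    = unary (reducesInside A) (apply₁↦ Q A)

  Ki⇝lKu : ∀ A → (A ^Ki) ⇝ (A ^lKu)
  Ki⇝lKu = reducesInside _↦_
    (λ { ⟨⊗⟩ _ _ → reduce (red⊗ _ _)
       ; ⟨&⟩ _ _ → nomatch λ _ ()
       ; ⟨⊕⟩ _ _ → reduce (red⊕ _ _)
       ; ⟨⊸⟩ _ _ → reduce (red⊸ _ _)
       })
    (λ { ⟨∀⟩ _ → nomatch λ _ ()
       ; ⟨∃⟩ _ → reduce (red∃ _)
       ; ⟨!⟩ _ → nomatch λ _ ()
       })

  Ki-reduces-by-transforms : ∀ A →
    ReducesInside ¬¬_ kolmogorov (TransformReduction ¬¬_ kolmogorov kuroda) useT (A ^Ki) (A ^lKu)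
  Ki-reduces-by-transforms = reducesInside _
    (λ { ⟨⊗⟩ _ _ → reduce (binary ⟨⊗⟩ _ _)
       ; ⟨&⟩ _ _ → reduce (binary ⟨&⟩ _ _)
       ; ⟨⊕⟩ _ _ → reduce (binary ⟨⊕⟩ _ _)
       ; ⟨⊸⟩ _ _ → reduce (binary ⟨⊸⟩ _ _)
       })
    (λ { ⟨∀⟩ _ → reduce (unary ⟨∀⟩ _)
       ; ⟨∃⟩ _ → reduce (unary ⟨∃⟩ _)
       ; ⟨!⟩ _ → reduce (unary ⟨!⟩ _)
       })

  lKu-simplifies-Ki : SimplificationFromInside ¬¬_ CLLb ILL⊥ _^lKu _^Ki
  lKu-simplifies-Ki = record
    { modular    = Ki-modular
    ; modular′   = lKu-modular
    ; equivalent = record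
      { sound      = Ki-sound
      ; sound′     = lKu-sound
      ; equivalent = λ A → ⊣⊢⇒Equivalent (Ki⊣⊢lKu A)
      }
    ; simplifies = kuroda-simplifies
    ; fromInside = Ki-reduces-by-transforms
    }

proposition13 : (L : Signature) → let open LinearLogic L in
    ((A : Formula) → (A ^Ki) ⇝ (A ^lKu))
    × SimplificationFromInside ¬¬_ CLLb ILL⊥ _^lKu _^Ki
    × (∀ F G → F ↦ G → Equivalent ILL⊥ F G)
proposition13 L =
  Ki⇝lKu L , lKu-simplifies-Ki L , λ F G r → ⊣⊢⇒Equivalent L (reduction-⊣⊢ L r)
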